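{- Let $R$ be a commutative ring with unity, let $\mathcal{A}$ be a commutative unital $R$-algebra, and let $\sigma,\tau$ be two different non-zero unital $R$-algebra endomorphisms of $\mathcal{A}$. Suppose that, as an $R$-module, $\mathcal{A}$ is of finite rank $n$ and has an $R$-basis of the form $\{1,\alpha,\alpha^{2},\dots,\alpha^{n-1}\}$ for some $\alpha\in\mathcal{A}$. Then a $(\sigma,\tau)$-derivation $D:\mathcal{A}\to\mathcal{A}$ is inner if and only if there exists some $\beta\in\mathcal{A}$ such that $D(\alpha)=\beta(\tau-\sigma)(\alpha)$.
   Context: A $(\sigma,\tau)$-derivation of $\mathcal{A}$ is an $R$-linear map $D:\mathcal{A}\to\mathcal{A}$ with $D(xy)=D(x)\tau(y)+\sigma(x)D(y)$ for all $x,y\in\mathcal{A}$. It is called inner if there exists $\beta\in\mathcal{A}$ with $D(x)=\beta\tau(x)-\sigma(x)\beta$ for all $x\in\mathcal{A}$. Here $(\tau-\sigma)(x)=\tau(x)-\sigma(x)$. -}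

module Defs where

open import Algebra.Bundles using (CommutativeRing)
open import Algebra.Module.Core using (Opₗ)
open import Algebra.Module.Bundles using (LeftModule)
open import Algebra.Module.Morphism.Structures using (module LeftModuleMorphisms)
open import Algebra.Module.Structures using (IsLeftModule)
open import Algebra.Morphism.Structures using (module RingMorphisms)
open import Data.Fin.Base using (Fin; toℕ)
open import Data.Nat.Base using (ℕ)
open import Data.Product.Base using (∃-syntax)
open import Data.Vec.Functional using (Vector)
open import Level using (_⊔_; suc)
open import Relation.Nullary.Negation.Core using (¬_)

import Algebra.Properties.CommutativeMonoid.Sum as Sum
import Algebra.Properties.Semiring.Exp as Exp

-- The module structure lives on the additive group of the ring. As R and A are
-- commutative, a left action and one compatibility law suffice.
record CommutativeAlgebra {r ℓr} (R : CommutativeRing r ℓr) a ℓa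
         : Set (r ⊔ ℓr ⊔ suc (a ⊔ ℓa)) where
  private
    module R = CommutativeRing R

  infixr 7 _*ₗ_

  field
    commutativeRing : CommutativeRing a ℓa

  open CommutativeRing commutativeRing public

  field
    _*ₗ_         : Opₗ R.Carrier Carrier
    isLeftModule : IsLeftModule R.ring _≈_ _+_ 0# -_ _*ₗ_
    *ₗ-*-assoc   : ∀ s x y → (s *ₗ x) * y ≈ s *ₗ (x * y)

  leftModule : LeftModule R.ring a ℓa
  leftModule = record { isLeftModule = isLeftModule }

  open LeftModule leftModule public using (rawLeftModule)

module _ {r ℓr m ℓm} {R : CommutativeRing r ℓr}
         (M : LeftModule (CommutativeRing.ring R) m ℓm) where

  private
    module R = CommutativeRing R
  open LeftModule M
  open Sum +ᴹ-commutativeMonoid using (sum)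

  linearCombination : ∀ {n} → Vector R.Carrier n → Vector Carrierᴹ n → Carrierᴹ
  linearCombination c b = sum λ i → c i *ₗ b i

  -- The basis is an indexed family, so linear independence rules out
  -- repetitions (unless R is trivial).
  record IsBasis {n : ℕ} (b : Vector Carrierᴹ n) : Set (r ⊔ ℓr ⊔ m ⊔ ℓm) where
    field
      linearlyIndependent : ∀ c → linearCombination c b ≈ᴹ 0ᴹ → ∀ i → c i R.≈ R.0#
      spanning            : ∀ x → ∃[ c ] x ≈ᴹ linearCombination c b

module Derivations {r ℓr a ℓa} {R : CommutativeRing r ℓr}
         (A : CommutativeAlgebra R a ℓa) where

  open CommutativeAlgebra A
  open Exp semiring using (_^_)
  open LeftModuleMorphisms rawLeftModule rawLeftModule using (IsLeftModuleHomomorphism)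
  open RingMorphisms rawRing rawRing using (IsRingHomomorphism)

  powers : Carrier → (n : ℕ) → Vector Carrier n
  powers α n i = α ^ toℕ i

  IsPowerBasis : Carrier → ℕ → Set (r ⊔ ℓr ⊔ a ⊔ ℓa)
  IsPowerBasis α n = IsBasis {R = R} leftModule (powers α n)

  -- IsRingHomomorphism includes preservation of 1#.
  record IsAlgebraEndomorphism (f : Carrier → Carrier) : Set (r ⊔ a ⊔ ℓa) where
    field
      isRingHomomorphism       : IsRingHomomorphism f
      isLeftModuleHomomorphism : IsLeftModuleHomomorphism f

  Different : (f g : Carrier → Carrier) → Set (a ⊔ ℓa)
  Different f g = ¬ (∀ x → f x ≈ g x)

  NonZeroMap : (Carrier → Carrier) → Set (a ⊔ ℓa)
  NonZeroMap f = ¬ (∀ x → f x ≈ 0#)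

  infixl 6 _⊖_
  _⊖_ : (f g : Carrier → Carrier) → Carrier → Carrier
  (f ⊖ g) x = f x - g x

  record IsDerivation (σ τ D : Carrier → Carrier) : Set (r ⊔ a ⊔ ℓa) where
    field
      isLinear : IsLeftModuleHomomorphism D
      leibniz  : ∀ x y → D (x * y) ≈ D x * τ y + σ x * D y

  IsInner : (σ τ D : Carrier → Carrier) → Set (a ⊔ ℓa)
  IsInner σ τ D = ∃[ β ] ∀ x → D x ≈ β * τ x - σ x * β

{-# OPTIONS --safe #-}

-- As A is commutative, D is inner precisely when D = β(τ − σ) for some β.
-- The map τ − σ is itself a (σ,τ)-derivation, (σ,τ)-derivations form an A-module,
-- and a (σ,τ)-derivation kills 1, so it is determined on all powers of α, hence on
-- A by linearity, by its value at α.

module Submission where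

open import Defs
open import Algebra.Bundles using (CommutativeRing)
open import Algebra.Module.Bundles using (LeftModule)
open import Algebra.Module.Morphism.Structures using (module LeftModuleMorphisms)
open import Algebra.Morphism.Structures using (module RingMorphisms)
open import Data.Fin.Base using (zero; suc; toℕ)
open import Data.Nat.Base using (ℕ; zero; suc)
open import Data.Product.Base using (∃-syntax; _,_)
open import Data.Vec.Functional using (Vector)
open import Function.Base using (_∘_)
open import Function.Bundles using (_⇔_; mk⇔)
import Algebra.Module.Morphism.Construct.Composition as Composition
import Algebra.Properties.CommutativeSemigroup as CommutativeSemigroupProperties
import Algebra.Properties.Ring as RingProperties
import Algebra.Properties.Semiring.Exp as Exp
import Relation.Binary.Reasoning.Setoid as SetoidReasoning

module _ {r ℓr m₁ ℓm₁ m₂ ℓm₂} {R : CommutativeRing r ℓr}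
         {M : LeftModule (CommutativeRing.ring R) m₁ ℓm₁}
         {N : LeftModule (CommutativeRing.ring R) m₂ ℓm₂} where

  private
    module M = LeftModule M
    module N = LeftModule N
  open LeftModuleMorphisms M.rawLeftModule N.rawLeftModule using (IsLeftModuleHomomorphism)
  open IsLeftModuleHomomorphism

  -- Induction on the length of the family: the empty combination is zero, which both maps preserve.
  -- A longer one unfolds definitionally to its head term plus the combination `rest` of the tails,
  -- so additivity splits off the head and the scalar is pulled out of each map.
  linearCombination-agree : ∀ {f g} → IsLeftModuleHomomorphism f → IsLeftModuleHomomorphism g →
    ∀ {n} (b : Vector M.Carrierᴹ n) → (∀ i → f (b i) N.≈ᴹ g (b i)) →
    ∀ c → f (linearCombination {R = R} M c b) N.≈ᴹ g (linearCombination {R = R} M c b)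
  linearCombination-agree f-lin g-lin {zero} b f≈g c =
    N.≈ᴹ-trans (0ᴹ-homo f-lin) (N.≈ᴹ-sym (0ᴹ-homo g-lin))
  linearCombination-agree {f} {g} f-lin g-lin {suc n} b f≈g c = begin
    f (c zero M.*ₗ b zero M.+ᴹ rest)         ≈⟨ +ᴹ-homo f-lin _ _ ⟩
    f (c zero M.*ₗ b zero) N.+ᴹ f rest       ≈⟨ N.+ᴹ-cong (*ₗ-homo f-lin _ _) f≈g-rest ⟩
    c zero N.*ₗ f (b zero) N.+ᴹ g rest       ≈⟨ N.+ᴹ-congʳ (N.*ₗ-congˡ (f≈g zero)) ⟩
    c zero N.*ₗ g (b zero) N.+ᴹ g rest       ≈⟨ N.+ᴹ-congʳ (*ₗ-homo g-lin _ _) ⟨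
    g (c zero M.*ₗ b zero) N.+ᴹ g rest       ≈⟨ +ᴹ-homo g-lin _ _ ⟨
    g (c zero M.*ₗ b zero M.+ᴹ rest)         ∎
    where
    open SetoidReasoning N.≈ᴹ-setoid
    rest = linearCombination {R = R} M (c ∘ suc) (b ∘ suc)
    f≈g-rest : f rest N.≈ᴹ g rest
    f≈g-rest = linearCombination-agree f-lin g-lin (b ∘ suc) (f≈g ∘ suc) (c ∘ suc)

  -- Spanning replaces `x` by a linear combination up to the setoid equality, which both maps
  -- respect.
  agreeOnBasis⇒≈ : ∀ {f g} → IsLeftModuleHomomorphism f → IsLeftModuleHomomorphism g →
    ∀ {n} {b : Vector M.Carrierᴹ n} → IsBasis {R = R} M b →
    (∀ i → f (b i) N.≈ᴹ g (b i)) → ∀ x → f x N.≈ᴹ g x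
  agreeOnBasis⇒≈ {f} {g} f-lin g-lin {b = b} basis f≈g x
    with c , x≈cb ← IsBasis.spanning basis x = begin
      f x                                    ≈⟨ ⟦⟧-cong f-lin x≈cb ⟩
      f (linearCombination {R = R} M c b)    ≈⟨ linearCombination-agree f-lin g-lin b f≈g c ⟩
      g (linearCombination {R = R} M c b)    ≈⟨ ⟦⟧-cong g-lin x≈cb ⟨
      g x                                    ∎
    where open SetoidReasoning N.≈ᴹ-setoid

module _ {r ℓr a ℓa} {R : CommutativeRing r ℓr} (A : CommutativeAlgebra R a ℓa) where

  open CommutativeAlgebra A
  open Derivations A
  open Exp semiring using (_^_)
  open LeftModule leftModule using (*ₗ-congˡ; *ₗ-distribˡ)
  open LeftModuleMorphisms rawLeftModule rawLeftModule using (IsLeftModuleHomomorphism)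
  open RingProperties ring
  open CommutativeSemigroupProperties +-commutativeSemigroup using (interchange)
  open CommutativeSemigroupProperties *-commutativeSemigroup using (x∙yz≈y∙xz)
  open SetoidReasoning setoid

  *-*ₗ-comm : ∀ s x y → x * (s *ₗ y) ≈ s *ₗ (x * y)
  *-*ₗ-comm s x y = begin
    x * (s *ₗ y)   ≈⟨ *-comm _ _ ⟩
    (s *ₗ y) * x   ≈⟨ *ₗ-*-assoc s y x ⟩
    s *ₗ (y * x)   ≈⟨ *ₗ-congˡ (*-comm y x) ⟩
    s *ₗ (x * y)   ∎

  mkLinear : ∀ {f} → (∀ {x y} → x ≈ y → f x ≈ f y) → (∀ x y → f (x + y) ≈ f x + f y) →
    f 0# ≈ 0# → (∀ x → f (- x) ≈ - f x) → (∀ s x → f (s *ₗ x) ≈ s *ₗ f x) →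
    IsLeftModuleHomomorphism f
  mkLinear f-cong +-homo 0#-homo -‿homo *ₗ-homo = record
    { +ᴹ-isGroupHomomorphism = record
      { isMonoidHomomorphism = record
        { isMagmaHomomorphism = record
          { isRelHomomorphism = record { cong = f-cong }
          ; homo              = +-homo
          }
        ; ε-homo = 0#-homo
        }
      ; ⁻¹-homo = -‿homo
      }
    ; *ₗ-homo = *ₗ-homo
    }

  *-isLinear : ∀ β → IsLeftModuleHomomorphism (β *_)
  *-isLinear β = mkLinear *-congˡ (distribˡ β) (zeroʳ β)
    (λ x → sym (-‿distribʳ-* β x)) (λ s x → *-*ₗ-comm s β x)

  -- By uniqueness of additive inverses: the two scaled terms add up to `s *ₗ 0#`.
  *ₗ-‿comm : ∀ s x → s *ₗ (- x) ≈ - (s *ₗ x)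
  *ₗ-‿comm s x = +-inverseʳ-unique _ _ (begin
    s *ₗ x + s *ₗ (- x)   ≈⟨ *ₗ-distribˡ s x (- x) ⟨
    s *ₗ (x - x)          ≈⟨ *ₗ-congˡ (-‿inverseʳ x) ⟩
    s *ₗ 0#               ≈⟨ LeftModule.*ₗ-zeroʳ leftModule s ⟩
    0#                    ∎)

  ⊖-isLinear : ∀ {f g} → IsLeftModuleHomomorphism f → IsLeftModuleHomomorphism g →
    IsLeftModuleHomomorphism (f ⊖ g)
  ⊖-isLinear {f} {g} f-lin g-lin = mkLinear
    (λ x≈y → +-cong (F.⟦⟧-cong x≈y) (-‿cong (G.⟦⟧-cong x≈y)))
    (λ x y → begin
      f (x + y) - g (x + y)          ≈⟨ +-cong (F.+ᴹ-homo x y) (-‿cong (G.+ᴹ-homo x y)) ⟩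
      f x + f y - (g x + g y)        ≈⟨ +-congˡ (-‿+-comm _ _) ⟨
      f x + f y + (- g x + - g y)    ≈⟨ interchange _ _ _ _ ⟩
      f x - g x + (f y - g y)        ∎)
    (trans (+-cong F.0ᴹ-homo (-‿cong G.0ᴹ-homo)) (-‿inverseʳ 0#))
    (λ x → trans (+-cong (F.-ᴹ-homo x) (-‿cong (G.-ᴹ-homo x))) (-‿+-comm _ _))
    (λ s x → begin
      f (s *ₗ x) - g (s *ₗ x)        ≈⟨ +-cong (F.*ₗ-homo s x) (-‿cong (G.*ₗ-homo s x)) ⟩
      s *ₗ f x - s *ₗ g x            ≈⟨ +-congˡ (*ₗ-‿comm s (g x)) ⟨
      s *ₗ f x + s *ₗ (- g x)        ≈⟨ *ₗ-distribˡ s _ _ ⟨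
      s *ₗ (f x - g x)               ∎)
    where
    module F = IsLeftModuleHomomorphism f-lin
    module G = IsLeftModuleHomomorphism g-lin

  [x-y]+[y-z]≈x-z : ∀ x y z → (x - y) + (y - z) ≈ x - z
  [x-y]+[y-z]≈x-z x y z = trans (+-assoc _ _ _) (+-congˡ (\\-leftDividesʳ y (- z)))

  module _ {σ τ : Carrier → Carrier}
           (σ-endo : IsAlgebraEndomorphism σ) (τ-endo : IsAlgebraEndomorphism τ) where

    private
      module σ = IsAlgebraEndomorphism σ-endo
      module τ = IsAlgebraEndomorphism τ-endo
    open RingMorphisms rawRing rawRing using (module IsRingHomomorphism)
    open IsRingHomomorphism using (*-homo; 1#-homo)

    -- Multiplicativity turns the left side of the Leibniz rule into a difference of products.
    -- Inserting the mixed term `σ x * τ y` telescopes it into two differences, one with common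
    -- factor `τ y` and the other with common factor `σ x`.
    τ⊖σ-isDerivation : IsDerivation σ τ (τ ⊖ σ)
    τ⊖σ-isDerivation = record
      { isLinear = ⊖-isLinear τ.isLeftModuleHomomorphism σ.isLeftModuleHomomorphism
      ; leibniz  = λ x y → begin
          τ (x * y) - σ (x * y)
            ≈⟨ +-cong (*-homo τ.isRingHomomorphism x y) (-‿cong (*-homo σ.isRingHomomorphism x y)) ⟩
          τ x * τ y - σ x * σ y
            ≈⟨ [x-y]+[y-z]≈x-z _ (σ x * τ y) _ ⟨
          (τ x * τ y - σ x * τ y) + (σ x * τ y - σ x * σ y)
            ≈⟨ +-cong ([y-z]x≈yx-zx _ _ _) (x[y-z]≈xy-xz _ _ _) ⟨
          (τ x - σ x) * τ y + σ x * (τ y - σ y) ∎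
      }

    -- Both endomorphisms fix `1#`, so the Leibniz rule at `1# * 1#` makes `D 1#` equal to its own
    -- double.
    isDerivation⇒D1≈0 : ∀ {D} → IsDerivation σ τ D → D 1# ≈ 0#
    isDerivation⇒D1≈0 {D} D-der = x+x≈x⇒x≈0 (D 1#) (begin
      D 1# + D 1#                  ≈⟨ +-cong (*-identityʳ _) (*-identityˡ _) ⟨
      D 1# * 1# + 1# * D 1#        ≈⟨ +-cong (*-congˡ (1#-homo τ.isRingHomomorphism))
                                             (*-congʳ (1#-homo σ.isRingHomomorphism)) ⟨
      D 1# * τ 1# + σ 1# * D 1#    ≈⟨ leibniz 1# 1# ⟨
      D (1# * 1#)                  ≈⟨ ⟦⟧-cong (*-identityˡ 1#) ⟩
      D 1#                         ∎)
      where
      open IsDerivation D-der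
      open IsLeftModuleHomomorphism isLinear

    -- Induction on the exponent. In the Leibniz expansion of `α * α ^ k` the factors `τ (α ^ k)`
    -- and `σ α` are the same for `D` and `E`, so only the values at `α` and at `α ^ k` have to be
    -- compared.
    agreeOnPowers : ∀ {D E} → IsDerivation σ τ D → IsDerivation σ τ E →
      ∀ {α} → D α ≈ E α → ∀ k → D (α ^ k) ≈ E (α ^ k)
    agreeOnPowers D-der E-der Dα≈Eα zero =
      -- `α ^ 0` is `1#`, where both derivations vanish.
      trans (isDerivation⇒D1≈0 D-der) (sym (isDerivation⇒D1≈0 E-der))
    agreeOnPowers {D} {E} D-der E-der {α} Dα≈Eα (suc k) = begin
      D (α * α ^ k)                        ≈⟨ IsDerivation.leibniz D-der _ _ ⟩
      D α * τ (α ^ k) + σ α * D (α ^ k)    ≈⟨ +-cong (*-congʳ Dα≈Eα)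
                                                (*-congˡ (agreeOnPowers D-der E-der Dα≈Eα k)) ⟩
      E α * τ (α ^ k) + σ α * E (α ^ k)    ≈⟨ IsDerivation.leibniz E-der _ _ ⟨
      E (α * α ^ k)                        ∎

    agreeOnGenerator⇒≈ : ∀ {D E} → IsDerivation σ τ D → IsDerivation σ τ E →
      ∀ {n α} → IsPowerBasis α n → D α ≈ E α → ∀ x → D x ≈ E x
    agreeOnGenerator⇒≈ D-der E-der basis Dα≈Eα =
      agreeOnBasis⇒≈ {R = R} {M = leftModule} {N = leftModule}
        (IsDerivation.isLinear D-der) (IsDerivation.isLinear E-der) basis
        -- The basis vector with index `i` is by definition `α ^ toℕ i`.
        (λ i → agreeOnPowers D-der E-der Dα≈Eα (toℕ i))

  -- The second Leibniz summand needs commutativity of the algebra to carry `β` past `σ x`; the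
  -- first only reassociates. Linearity holds because the map is `D` followed by multiplication by
  -- `β`.
  *-isDerivation : ∀ {σ τ D} β → IsDerivation σ τ D → IsDerivation σ τ (λ x → β * D x)
  *-isDerivation {σ} {τ} {D} β D-der = record
    { isLinear = Composition.isLeftModuleHomomorphism trans isLinear (*-isLinear β)
    ; leibniz  = λ x y → begin
        β * D (x * y)                          ≈⟨ *-congˡ (leibniz x y) ⟩
        β * (D x * τ y + σ x * D y)            ≈⟨ distribˡ _ _ _ ⟩
        β * (D x * τ y) + β * (σ x * D y)      ≈⟨ +-cong (sym (*-assoc _ _ _)) (x∙yz≈y∙xz _ _ _) ⟩
        β * D x * τ y + σ x * (β * D y)        ∎
    }
    where open IsDerivation D-der

  -- Commutativity makes `β` a common left factor. This links the definition of inner to the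
  -- condition at `α`, in both directions.
  inner≈β[τ⊖σ] : ∀ σ τ β x → β * τ x - σ x * β ≈ β * (τ ⊖ σ) x
  inner≈β[τ⊖σ] σ τ β x = begin
    β * τ x - σ x * β    ≈⟨ +-congˡ (-‿cong (*-comm (σ x) β)) ⟩
    β * τ x - β * σ x    ≈⟨ x[y-z]≈xy-xz β (τ x) (σ x) ⟨
    β * (τ x - σ x)      ∎

theorem2p29 : ∀ {r ℓr a ℓa} (R : CommutativeRing r ℓr) (A : CommutativeAlgebra R a ℓa) →
    let open CommutativeAlgebra A
        open Derivations A in
    (σ τ : Carrier → Carrier) →
    IsAlgebraEndomorphism σ → IsAlgebraEndomorphism τ →
    Different σ τ → NonZeroMap σ → NonZeroMap τ →
    (n : ℕ) (α : Carrier) → IsPowerBasis α n →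
    (D : Carrier → Carrier) → IsDerivation σ τ D →
    IsInner σ τ D ⇔ (∃[ β ] D α ≈ β * (τ ⊖ σ) α)
theorem2p29 R A σ τ σ-endo τ-endo _ _ _ n α basis D D-der = mk⇔
  -- Evaluate the inner formula at `α`.
  (λ (β , D≈inner) → β , trans (D≈inner α) (inner≈β[τ⊖σ] A σ τ β α))
  -- The same `β` serves globally: `D` and the multiple of `τ ⊖ σ` by `β` are derivations for the
  -- same pair that agree at `α`.
  (λ (β , Dα≈) → β , λ x → trans
    (agreeOnGenerator⇒≈ A σ-endo τ-endo D-der
      (*-isDerivation A β (τ⊖σ-isDerivation A σ-endo τ-endo)) basis Dα≈ x)
    (sym (inner≈β[τ⊖σ] A σ τ β x)))
  where open CommutativeAlgebra A using (trans; sym)
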